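{- Let $r\ge 1$ and $t\ge 1$ be integers. The threshold for paths of length $t$ is $1+a_t(\mathrm{PSG}_r)$. In other words, for all sufficiently large $n$ we have $f(n,r,k)<r-1+t$ if $k=a_t(\mathrm{PSG}_r)$, and $f(n,r,k)\ge r-1+t$ if $k=1+a_t(\mathrm{PSG}_r)$.
   Context: An $r$-digraph $G$ consists of a finite vertex set $V(G)$ and an edge set $E(G)$ whose elements are ordered lists of $r$ distinct vertices. An $(r,k)$-tournament ($0\le k\le r!$) is an $r$-digraph $G$ such that for every $r$-element set $S\subseteq V(G)$, exactly $k$ of the $r!$ orderings of $S$ are edges of $G$. The tight path $P^{(r)}_s$ is the $r$-digraph with $s$ distinct vertices $v_1,\ldots,v_s$ whose edges are exactly the lists of $r$ consecutive vertices $(v_i,\ldots,v_{i+r-1})$, $1\le i\le s-r+1$ (no edges if $s<r$). An $r$-digraph $G$ contains $P^{(r)}_s$ if there is an injection of its vertices into $V(G)$ mapping edges to edges. $f(n,r,k)$ is the maximum integer $s$ such that every $n$-vertex $(r,k)$-tournament contains a copy of $P^{(r)}_s$. The threshold for paths of length $t$ is the minimum $k$ such that $f(n,r,k)\ge r-1+t$ for all sufficiently large $n$. Two lists $(a_1,\ldots,a_s)$ and $(b_1,\ldots,b_s)$, each with distinct entries, pattern-match if for all $i<j$ we have $a_i<a_j$ if and only if $b_i<b_j$. The pattern-shift graph $\mathrm{PSG}_r$ is the digraph (loops allowed) whose vertices are the permutations of $[r]=\{1,\ldots,r\}$ written as lists, with an edge from $a$ to $b$ (possibly $a=b$) if and only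 if the list of the last $r-1$ entries of $a$ and the list of the first $r-1$ entries of $b$ pattern-match. For a digraph $G$, a walk of size $t$ is a sequence $w_1\ldots w_t$ of (not necessarily distinct) vertices such that $w_iw_{i+1}$ is an edge for $1\le i<t$, and $a_t(G)$ is the maximum size of a set of vertices of $G$ inducing a subgraph with no walk of size $t$. -}

module Defs where

open import Data.Fin using (Fin; toℕ) renaming (_<_ to _<ᶠ_)
open import Data.Fin.Properties using (all?; any?; toℕ-injective)
open import Data.Fin.Subset using (Subset; ∣_∣) renaming (_∈_ to _∈ˢ_)
open import Data.List using (List; length)
open import Data.List.Membership.Propositional using (_∈_)
import Data.List.Relation.Unary.Unique.Propositional as List
open import Data.Nat using (ℕ; suc; _+_; _∸_; _≤_; _<_; _≥_; _!; _≟_; NonZero)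
open import Data.Nat.Properties using (+-cancelˡ-≡)
open import Data.Product using (∃; Σ; _×_; _,_; proj₁)
open import Data.Refinement using (Refinement-syntax; value)
open import Data.Vec using (Vec; lookup; map; tail; init)
open import Data.Vec.Membership.Propositional using () renaming (_∈_ to _∈ᵛ_)
open import Data.Vec.Properties using (tabulate∘lookup)
open import Data.Vec.Relation.Unary.Linked using (Linked)
open import Data.Vec.Relation.Unary.Unique.Propositional using (Unique)
open import Data.Vec.Relation.Unary.Unique.Propositional.Properties using (tabulate⁺)
open import Function using (Injective; _⇔_; _on_)
open import Level using (0ℓ)
open import Relation.Binary using (Rel)
open import Relation.Binary.PropositionalEquality using (_≡_; subst; sym; trans; cong)
open import Relation.Nullary using (¬_)
open import Relation.Unary using (Pred; Decidable)

IsMax : ∀ {ℓ} → Pred ℕ ℓ → Pred ℕ ℓ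
IsMax P m = P m × (∀ k → P k → k ≤ m)

IsMin : ∀ {ℓ} → Pred ℕ ℓ → Pred ℕ ℓ
IsMin P m = P m × (∀ k → P k → m ≤ k)

Eventually : ∀ {ℓ} → Pred ℕ ℓ → Set ℓ
Eventually P = ∃ λ N → ∀ n → n ≥ N → P n

-- Exactly k elements satisfy P.
Exactly : {A : Set} → ℕ → Pred A 0ℓ → Set
Exactly {A} k P = Σ (List A) λ xs →
  List.Unique xs × length xs ≡ k × (∀ x → x ∈ xs ⇔ P x)

-- r-digraphs whose vertex set is Fin n. Decidability of E expresses that the
-- edges form a finite set, there being only finitely many lists of r vertices.
record RDigraph (r n : ℕ) : Set₁ where
  field
    E        : Pred (Vec (Fin n) r) 0ℓ
    E?       : Decidable E
    distinct : ∀ {v} → E v → Unique v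

open RDigraph public

IsOrderingOf : ∀ {n r} → Subset n → Pred (Vec (Fin n) r) 0ℓ
IsOrderingOf S v = Unique v × (∀ x → x ∈ᵛ v ⇔ x ∈ˢ S)

IsTournament : ∀ {r n} → ℕ → RDigraph r n → Set
IsTournament {r} {n} k G = ∀ (S : Subset n) → ∣ S ∣ ≡ r →
  Exactly k λ v → IsOrderingOf S v × E G v

_Contains_ : ∀ {r n s} → RDigraph r n → RDigraph r s → Set
_Contains_ {n = n} {s} G H = Σ (Fin s → Fin n) λ φ →
  Injective _≡_ _≡_ φ × (∀ {v} → E H v → E G (map φ v))

-- The starting position i of a window ranges over s - r + 1 values, none if
-- s < r; this count is suc s ∸ r (and not suc (s ∸ r)).
tightPath : ∀ r s → RDigraph r s
tightPath r s = record
  { E        = Window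
  ; E?       = λ v → any? λ i → all? λ j → toℕ (lookup v j) ≟ toℕ i + toℕ j
  ; distinct = window-distinct
  }
  where
  Window : Pred (Vec (Fin s) r) 0ℓ
  Window v = Σ (Fin (suc s ∸ r)) λ i → ∀ j → toℕ (lookup v j) ≡ toℕ i + toℕ j

  window-distinct : ∀ {v} → Window v → Unique v
  window-distinct {v} (i , eq) = subst Unique (tabulate∘lookup v)
    (tabulate⁺ λ {j} {k} p → toℕ-injective (+-cancelˡ-≡ (toℕ i) (toℕ j) (toℕ k)
      (trans (sym (eq j)) (trans (cong toℕ p) (eq k)))))

-- f[ n , r , k ]≡ s is the graph of the partial function f; it is a function
-- on k ≤ r !, while for larger k it may be undefined.
f[_,_,_]≡_ : ℕ → ℕ → ℕ → ℕ → Set₁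
f[ n , r , k ]≡ s =
  IsMax (λ s′ → ∀ (G : RDigraph r n) → IsTournament k G → G Contains tightPath r s′) s

f[_,_,_]≥_ : ℕ → ℕ → ℕ → ℕ → Set₁
f[ n , r , k ]≥ m = ∃ λ s → f[ n , r , k ]≡ s × s ≥ m

f[_,_,_]<_ : ℕ → ℕ → ℕ → ℕ → Set₁
f[ n , r , k ]< m = ∃ λ s → f[ n , r , k ]≡ s × s < m

IsThreshold : (r t : ℕ) → Pred ℕ _
IsThreshold r t = IsMin λ k →
  k ≤ r ! × Eventually (λ n → f[ n , r , k ]≥ (r ∸ 1 + t))

record Digraph : Set₁ where
  field
    V   : Set
    _⟶_ : Rel V 0ℓ

open Digraph using (V)

PatternMatch : ∀ {m n s} → Vec (Fin m) s → Vec (Fin n) s → Set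
PatternMatch a b = ∀ i j → i <ᶠ j →
  lookup a i <ᶠ lookup a j ⇔ lookup b i <ᶠ lookup b j

-- Fin r plays the role of [r]. The proof of distinctness is irrelevant, so
-- that equal lists are equal permutations.
Perm : ℕ → Set
Perm r = [ v ∈ Vec (Fin r) r ∣ Unique v ]

PSG : (r : ℕ) .{{_ : NonZero r}} → Digraph
PSG r@(suc _) = record
  { V   = Perm r
  ; _⟶_ = λ a b → PatternMatch (tail (value a)) (init (value b))
  }

Walk : Digraph → ℕ → Set
Walk G t = Σ (Vec (V G) t) (Linked (Digraph._⟶_ G))

induced : (G : Digraph) → List (V G) → Digraph
induced G S = record
  { V   = ∃ λ v → v ∈ S
  ; _⟶_ = Digraph._⟶_ G on proj₁
  }

-- Sets of vertices are duplicate-free lists.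
a[_,_]≡_ : ℕ → Digraph → ℕ → Set
a[ t , G ]≡ m = IsMax (λ m′ → Σ (List (V G)) λ S →
  List.Unique S × length S ≡ m′ × ¬ Walk (induced G S) t) m

{-# OPTIONS --safe #-}
-- If S is a set of patterns inducing no walk of size t, take as edges all lists
-- of vertices whose pattern lies in S: the windows of a tight path of length t
-- would have patterns forming a walk of size t in S. Conversely, colour each
-- r-set of an (r, 1 + a_t)-tournament by the set of patterns of its edges. By
-- Ramsey's theorem some large vertex set is monochromatic; its 1 + a_t patterns
-- contain a walk of size t, and any walk in PSG_r is the sequence of window
-- patterns of some list of distinct numbers, since one can always insert the
-- next entry into the gap prescribed by the next pattern.
module Submission where

open import Defs
open import Data.Bool using (Bool; true; false; T)
open import Data.Bool.Properties using (T?)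
open import Data.Empty using (⊥-elim)
open import Data.Fin as Fin using
  (Fin; zero; suc; toℕ; fromℕ<; inject₁; inject≤; punchIn; punchOut; _↑ˡ_; _↑ʳ_)
  renaming (_<_ to _<ᶠ_)
open import Data.Fin.Induction using (<-weakInduction)
open import Data.Fin.Properties as Fin using
  ( toℕ-injective; toℕ<n; toℕ≤pred[n]; toℕ-fromℕ<; toℕ-inject₁; toℕ-inject≤; toℕ-↑ˡ; toℕ-↑ʳ; toℕ-cast
  ; injective⇒≤; punchIn-punchOut; punchIn-injective; punchInᵢ≢i; punchOut-injective )
open import Data.Fin.Subset using (Subset; inside; outside; ∣_∣) renaming (_∈_ to _∈ˢ_)
import Data.Fin.Subset.Properties as Subset
open import Data.Irrelevant using ([_])
open import Data.List as List using (List; []; _∷_; length; filter; deduplicate; cartesianProductWith; allFin; take)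
open import Data.List.Membership.Propositional using (_∈_; find; lose)
open import Data.List.Membership.Propositional.Properties using
  ( ∈-lookup; ∈-filter⁺; ∈-filter⁻; ∈-allFin; ∈-map⁺; ∈-map⁻; ∈-cartesianProductWith⁺; ∈-deduplicate⁺ )
open import Data.List.Properties using (length-map; length-++; length-tabulate; length-take)
open import Data.List.Relation.Binary.Sublist.Propositional using
  (_⊆_; []; _∷_; _∷ʳ_; minimum; ⊆-refl; ⊆-trans) renaming (lookup to ⊆-lookup)
open import Data.List.Relation.Binary.Sublist.Propositional.Properties using (All-resp-⊆; take-⊆)
open import Data.List.Relation.Unary.All as All using (All; []; _∷_)
open import Data.List.Relation.Unary.AllPairs using (AllPairs; []; _∷_)
import Data.List.Relation.Unary.AllPairs.Properties as AllPairs
open import Data.List.Relation.Unary.Any as Any using (here; there)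
open import Data.List.Relation.Unary.Any.Properties using (lookup-index)
import Data.List.Relation.Unary.Unique.DecPropositional as DecUnique
open import Data.List.Relation.Unary.Unique.DecPropositional.Properties using (deduplicate-!)
import Data.List.Relation.Unary.Unique.Propositional as List
import Data.List.Relation.Unary.Unique.Propositional.Properties as Uniqueₗ
open import Data.Nat as ℕ using (ℕ; zero; suc; _+_; _*_; _∸_; _⊔_; _≤_; _<_; _≥_; _!; z≤n; s≤s; NonZero)
open import Data.Nat.Properties as ℕ hiding (suc-injective; _≟_; _≤?_; _<?_)
open import Data.Product using (∃; Σ; _×_; _,_; proj₁; proj₂; map₂)
open import Data.Refinement using (value; value-injective) renaming (_,_ to _,ʳ_)
import Data.Refinement.Properties as Refinement
open import Data.Sum using (_⊎_; inj₁; inj₂)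
open import Data.Vec as Vec using (Vec; []; _∷_; lookup; tabulate; tail; init; toList; fromList; here; there)
import Data.Vec.Membership.DecPropositional as DecMembershipᵛ
open import Data.Vec.Membership.Propositional using () renaming (_∈_ to _∈ᵛ_)
import Data.Vec.Membership.Propositional.Properties as ∈ᵛ
open import Data.Vec.Properties as Vec using
  (lookup-map; lookup∘tabulate; lookup⇒[]=; []=⇒lookup; toList∘fromList; length-toList; map-cong)
import Data.Vec.Relation.Unary.All as Allᵛ
import Data.Vec.Relation.Unary.All.Properties as Allᵛ
open import Data.Vec.Relation.Unary.AllPairs as AllPairsᵛ using ([]; _∷_)
import Data.Vec.Relation.Unary.Any as Anyᵛ
import Data.Vec.Relation.Unary.Any.Properties as Anyᵛ
open import Data.Vec.Relation.Unary.Linked using (Linked; []; [-]; _∷_; linked?)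
import Data.Vec.Relation.Unary.Linked.Properties as Linked
open import Data.Vec.Relation.Unary.Unique.Propositional using (Unique)
import Data.Vec.Relation.Unary.Unique.Propositional.Properties as Uniqueᵛ
open import Function using (Injective; _∘_; id; Equivalence; mk⇔; _⇔_)
open import Function.Construct.Composition using (_⇔-∘_)
open import Function.Construct.Symmetry using (⇔-sym)
open import Level using (0ℓ)
open import Relation.Binary using (Rel; DecidableEquality; tri<; tri≈; tri>)
open import Relation.Binary.PropositionalEquality
open import Relation.Nullary using (¬_; Dec; yes; no; contradiction; does)
open import Relation.Nullary.Decidable using
  (map′; _×-dec_; _→-dec_; ¬?; isYes; toWitness; fromWitness; decidable-stable; recompute; dec-true)
open import Relation.Unary using (Pred; Decidable; ∁)
open Equivalence using (to; from)

-- The theorem also asserts that `f` and `a_t` exist as maxima, and it is proved constructively: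
-- both are found by bounded search, so walks, tournaments and embeddings all have to be decidable.
-- For `k = 1 + a_t` the search needs `1 + a_t ≤ r!`, since only then is some `(r, k)`-tournament at
-- hand to bound the forced paths. The reason is that the identity permutation carries a loop in the
-- pattern-shift graph, so a set without walks of size `t` omits it. Each pattern gives a
-- two-colouring of its own, and these are made homogeneous one after the other; a single r-set
-- inside the result then shows which patterns are edges. Minimality of the threshold concerns every
-- `k ≤ a_t`. No monotonicity of `f` in `k` is involved: `k` patterns taken from an extremal set
-- still induce no walk of size `t`. This half holds for every `n`. Most statements use uniformity
-- `suc r`, so consecutive windows share `r` vertices and `t` windows span `t + r` vertices.

-- Injections, counting and bounded search

covered⇒≤ : ∀ {A : Set} {m n} {f : Fin m → A} (g : Fin n → A) → Injective _≡_ _≡_ f →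
  (∀ i → ∃ λ j → g j ≡ f i) → m ≤ n
covered⇒≤ g f-inj cover = injective⇒≤ {f = proj₁ ∘ cover} λ {i} {j} eq →
  f-inj (trans (sym (proj₂ (cover i))) (trans (cong g eq) (proj₂ (cover j))))

-- Pigeonhole: if `y` were missed, `punchOut` at `y` would squeeze `f` into an injection from
-- `Fin (suc n)` to `Fin n`.
injective⇒surjective : ∀ {n} {f : Fin n → Fin n} → Injective _≡_ _≡_ f → ∀ y → ∃ λ x → f x ≡ y
injective⇒surjective {zero}  f-inj ()
injective⇒surjective {suc n} {f} f-inj y with Fin.any? (λ x → f x Fin.≟ y)
... | yes hit = hit
... | no miss = contradiction
  (injective⇒≤ {f = λ x → punchOut (y≢f x)} (f-inj ∘ punchOut-injective (y≢f _) (y≢f _))) ℕ.1+n≰n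
  where
  y≢f : ∀ x → y ≢ f x
  y≢f x eq = miss (x , sym eq)

listLookup-injective : ∀ {A : Set} {xs : List A} → List.Unique xs → Injective _≡_ _≡_ (List.lookup xs)
listLookup-injective (_ ∷ _)   {zero}  {zero}  _  = refl
listLookup-injective (x∉ ∷ _)  {zero}  {suc j} eq = contradiction eq (All.lookup x∉ (∈-lookup j))
listLookup-injective (x∉ ∷ _)  {suc i} {zero}  eq = contradiction (sym eq) (All.lookup x∉ (∈-lookup i))
listLookup-injective (_ ∷ xs!) {suc i} {suc j} eq = cong suc (listLookup-injective xs! eq)

unique-⊆⇒length≤ : ∀ {A : Set} {xs ys : List A} → List.Unique xs → (∀ {x} → x ∈ xs → x ∈ ys) →
  length xs ≤ length ys
unique-⊆⇒length≤ {ys = ys} xs! xs⊆ys = covered⇒≤ (List.lookup ys) (listLookup-injective xs!) λ i →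
  Any.index (xs⊆ys (∈-lookup i)) , sym (lookup-index (xs⊆ys (∈-lookup i)))

exactly-unique : ∀ {A : Set} {P : Pred A 0ℓ} {k l} → Exactly k P → Exactly l P → k ≡ l
exactly-unique (xs , xs! , refl , xs⇔P) (ys , ys! , refl , ys⇔P) = ≤-antisym
  (unique-⊆⇒length≤ xs! λ {x} → from (ys⇔P x) ∘ to (xs⇔P x))
  (unique-⊆⇒length≤ ys! λ {x} → from (xs⇔P x) ∘ to (ys⇔P x))

exactly-resp : ∀ {A : Set} {P Q : Pred A 0ℓ} {k} → (∀ x → P x ⇔ Q x) → Exactly k P → Exactly k Q
exactly-resp P⇔Q (xs , xs! , len , xs⇔P) = xs , xs! , len , λ x →
  mk⇔ (to (P⇔Q x) ∘ to (xs⇔P x)) (from (xs⇔P x) ∘ from (P⇔Q x))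

-- Downward search from the bound: a failed test at `suc b` lowers the bound to `b`. `P` need not be
-- closed downwards.
greatest : ∀ {ℓ} {P : Pred ℕ ℓ} → Decidable P → P 0 → ∀ b → (∀ m → P m → m ≤ b) → ∃ (IsMax P)
greatest P? P0 zero    bound = 0 , P0 , bound
greatest P? P0 (suc b) bound with P? (suc b)
... | yes Pb = suc b , Pb , bound
... | no ¬Pb = greatest P? P0 b λ m Pm →
  ℕ.≤-pred (≤∧≢⇒< (bound m Pm) λ { refl → ¬Pb Pm })

-- Decidability over finite types

-- Repetitions are allowed, as the list mostly serves for searching; `exactly?` removes them before
-- it counts.
record Finite (A : Set) : Set where
  field
    elements : List A
    complete : ∀ x → x ∈ elements

open Finite {{...}}

∃? : ∀ {A : Set} {{_ : Finite A}} {P : Pred A 0ℓ} → Decidable P → Dec (∃ P)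
∃? P? = map′ Any.satisfied (λ { (x , Px) → Any.map (λ { refl → Px }) (complete x) }) (Any.any? P? elements)

∀? : ∀ {A : Set} {{_ : Finite A}} {P : Pred A 0ℓ} → Decidable P → Dec (∀ x → P x)
∀? P? = map′ (λ ¬∃ x → decidable-stable (P? x) λ ¬Px → ¬∃ (x , ¬Px)) (λ ∀P (x , ¬Px) → ¬Px (∀P x))
  (¬? (∃? (¬? ∘ P?)))

exactly? : ∀ {A : Set} {{_ : Finite A}} → DecidableEquality A →
  ∀ {P : Pred A 0ℓ} → Decidable P → ∀ k → Dec (Exactly k P)
exactly? {A} _≟ᴬ_ {P} P? k = map′ (λ { refl → count }) (exactly-unique count) (length xs ℕ.≟ k)
  where
  xs : List A
  xs = filter P? (deduplicate _≟ᴬ_ elements)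
  count : Exactly (length xs) P
  count = xs , Uniqueₗ.filter⁺ P? (deduplicate-! _≟ᴬ_ elements) , refl , λ x →
    mk⇔ (proj₂ ∘ ∈-filter⁻ P? {xs = deduplicate _≟ᴬ_ elements}) (∈-filter⁺ P? (∈-deduplicate⁺ _≟ᴬ_ (complete x)))

instance
  finite-Bool : Finite Bool
  finite-Bool = record { elements = true ∷ false ∷ [] ; complete = λ where
    true  → here refl
    false → there (here refl) }

  finite-Fin : ∀ {n} → Finite (Fin n)
  finite-Fin = record { elements = allFin _ ; complete = ∈-allFin }

  finite-Vec : ∀ {A : Set} {n} {{_ : Finite A}} → Finite (Vec A n)
  finite-Vec {n = zero}  = record { elements = [] ∷ [] ; complete = λ { [] → here refl } }
  finite-Vec {n = suc n} = record
    { elements = cartesianProductWith _∷_ elements elements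
    ; complete = λ { (x ∷ xs) → ∈-cartesianProductWith⁺ _∷_ (complete x) (complete xs) } }

  finite-∈ : ∀ {A : Set} {xs : List A} → Finite (∃ λ x → x ∈ xs)
  finite-∈ {xs = []}     = record { elements = [] ; complete = λ () }
  finite-∈ {xs = x ∷ xs} = record
    { elements = (x , here refl) ∷ List.map (map₂ there) elements
    ; complete = λ where
        (_ , here refl)  → here refl
        (y , there y∈xs) → there (∈-map⁺ (map₂ there) (complete (y , y∈xs))) }

-- Permutations and their number

unique⇒injective : ∀ {A : Set} {n} {v : Vec A n} → Unique v → Injective _≡_ _≡_ (lookup v)
unique⇒injective v! = Uniqueᵛ.lookup-injective v! _ _

injective⇒unique : ∀ {A : Set} {n} {v : Vec A n} → Injective _≡_ _≡_ (lookup v) → Unique v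
injective⇒unique {v = v} inj = subst Unique (Vec.tabulate∘lookup v) (Uniqueᵛ.tabulate⁺ inj)

unique? : ∀ {A : Set} → DecidableEquality A → ∀ {n} → Decidable (Unique {A = A} {n})
unique? _≟ᴬ_ = AllPairsᵛ.allPairs? λ x y → ¬? (x ≟ᴬ y)

-- The distinctness proof stored in `p` is irrelevant; decidability of `Unique` recomputes a
-- relevant one.
perm-unique : ∀ {r} (p : Perm r) → Unique (value p)
perm-unique (v ,ʳ [ v! ]) = recompute (unique? Fin._≟_ v) v!

perm-injective : ∀ {r} (p : Perm r) → Injective _≡_ _≡_ (lookup (value p))
perm-injective p = unique⇒injective (perm-unique p)

perm-surjective : ∀ {r} (p : Perm r) y → ∃ λ x → lookup (value p) x ≡ y
perm-surjective p = injective⇒surjective (perm-injective p)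

vec-ext : ∀ {A : Set} {n} {v w : Vec A n} → (∀ i → lookup v i ≡ lookup w i) → v ≡ w
vec-ext {v = v} {w} eq =
  trans (sym (Vec.tabulate∘lookup v)) (trans (Vec.tabulate-cong eq) (Vec.tabulate∘lookup w))

map-injective : ∀ {A B : Set} {f : A → B} → Injective _≡_ _≡_ f →
  ∀ {n} → Injective _≡_ _≡_ (Vec.map {n = n} f)
map-injective f-inj {x = []}    {[]}       _  = refl
map-injective f-inj {x = _ ∷ _} {_ ∷ _} eq =
  cong₂ _∷_ (f-inj (Vec.∷-injectiveˡ eq)) (map-injective f-inj (Vec.∷-injectiveʳ eq))

_≟ᵖ_ : ∀ {r} → DecidableEquality (Perm r)
_≟ᵖ_ = Refinement._≟_ (Vec.≡-dec Fin._≟_)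

module _ {r : ℕ} where

  -- One step of the Lehmer code: `punchIn i` relabels the remaining entries so that they avoid the
  -- first entry `i`. Being a bijection from `Fin (suc r) × Perm r`, it yields the recursion of the
  -- factorial.
  consPerm : Fin (suc r) → Perm r → Perm (suc r)
  consPerm i (v ,ʳ [ v! ]) = i ∷ Vec.map (punchIn i) v ,ʳ [ cons-unique v! ]
    where
    cons-unique : Unique v → Unique (i ∷ Vec.map (punchIn i) v)
    cons-unique v! = Allᵛ.map⁺ (Allᵛ.universal (λ j → punchInᵢ≢i i j ∘ sym) v)
      ∷ Uniqueᵛ.map⁺ (punchIn-injective i _ _) v!

  consPerm-injective : ∀ {i j p q} → consPerm i p ≡ consPerm j q → i ≡ j × p ≡ q
  consPerm-injective {i} eq with Vec.∷-injective (cong value eq)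
  ... | refl , tails = refl , value-injective (map-injective (punchIn-injective i _ _) tails)

  consPerm-surjective : ∀ p → ∃ λ i → ∃ λ q → consPerm i q ≡ p
  consPerm-surjective p@(i ∷ v ,ʳ _) with perm-unique p
  ... | i∉ ∷ v! = i , (w ,ʳ [ w! ]) , value-injective (cong (i ∷_) map-w)
    where
    i≢ : ∀ k → i ≢ lookup v k
    i≢ k = Allᵛ.lookup⁺ i∉ k
    w : Vec (Fin r) r
    w = tabulate λ k → punchOut (i≢ k)
    w! : Unique w
    w! = Uniqueᵛ.tabulate⁺ λ {k} {l} → Uniqueᵛ.lookup-injective v! k l ∘ punchOut-injective (i≢ k) (i≢ l)
    map-w : Vec.map (punchIn i) w ≡ v
    map-w = vec-ext λ k → begin
      lookup (Vec.map (punchIn i) w) k    ≡⟨ lookup-map k (punchIn i) w ⟩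
      punchIn i (lookup w k)              ≡⟨ cong (punchIn i) (Vec.lookup∘tabulate _ k) ⟩
      punchIn i (punchOut (i≢ k))         ≡⟨ punchIn-punchOut (i≢ k) ⟩
      lookup v k                          ∎
      where open ≡-Reasoning

length-cartesianProductWith : ∀ {A B C : Set} (f : A → B → C) xs ys →
  length (cartesianProductWith f xs ys) ≡ length xs * length ys
length-cartesianProductWith f []       ys = refl
length-cartesianProductWith f (x ∷ xs) ys = trans (length-++ (List.map (f x) ys))
  (cong₂ _+_ (length-map (f x) ys) (length-cartesianProductWith f xs ys))

allPerms : ∀ r → List (Perm r)
allPerms zero    = ([] ,ʳ [ [] ]) ∷ []
allPerms (suc r) = cartesianProductWith consPerm (allFin (suc r)) (allPerms r)

allPerms-unique : ∀ r → List.Unique (allPerms r)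
allPerms-unique zero    = [] ∷ []
allPerms-unique (suc r) =
  Uniqueₗ.cartesianProductWith⁺ consPerm consPerm-injective (Uniqueₗ.allFin⁺ (suc r)) (allPerms-unique r)

allPerms-complete : ∀ {r} p → p ∈ allPerms r
allPerms-complete {zero}  ([] ,ʳ _) = here refl
allPerms-complete {suc r} p with consPerm-surjective p
... | i , q , refl = ∈-cartesianProductWith⁺ consPerm (∈-allFin i) (allPerms-complete q)

length-allPerms : ∀ r → length (allPerms r) ≡ r !
length-allPerms zero    = refl
length-allPerms (suc r) = begin
  length (allPerms (suc r))                          ≡⟨ length-cartesianProductWith consPerm (allFin (suc r)) (allPerms r) ⟩
  length (allFin (suc r)) * length (allPerms r)      ≡⟨ cong₂ _*_ (length-tabulate {n = suc r} id) (length-allPerms r) ⟩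
  suc r !                                            ∎
  where open ≡-Reasoning

instance
  finite-Perm : ∀ {r} → Finite (Perm r)
  finite-Perm = record { elements = allPerms _ ; complete = allPerms-complete }

-- Ramsey's theorem

-- An r-subset is represented by a sublist of length `r`, in the order inherited from `ys`, so `A`
-- itself needs no order.
Homogeneous : ∀ {A : Set} {r} → Pred (Vec A r) 0ℓ → Pred (List A) 0ℓ
Homogeneous P ys = ∀ us → toList us ⊆ ys → P us

homogeneous-⊆ : ∀ {A : Set} {r} {P : Pred (Vec A r) 0ℓ} {xs ys} → xs ⊆ ys → Homogeneous P ys → Homogeneous P xs
homogeneous-⊆ xs⊆ys hom us us⊆xs = hom us (⊆-trans us⊆xs xs⊆ys)

homogeneous-∷ : ∀ {A : Set} {r} {P : Pred (Vec A (suc r)) 0ℓ} {x ys} →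
  Homogeneous (P ∘ (x ∷_)) ys → Homogeneous P ys → Homogeneous P (x ∷ ys)
homogeneous-∷ homₓ hom (_ ∷ us) (refl ∷ us⊆ys) = homₓ us us⊆ys
homogeneous-∷ homₓ hom us       (_ ∷ʳ us⊆ys)   = hom us us⊆ys

HomogeneousSublist : ∀ {A : Set} {r} → Pred (Vec A r) 0ℓ → ℕ → List A → Set
HomogeneousSublist P m xs = ∃ λ ys → ys ⊆ xs × m ≤ length ys × Homogeneous P ys

-- R(1 + r; 1 + p, 1 + q) ≤ 1 + R(r; R(1 + r; p, 1 + q), R(1 + r; 1 + p, q))
ramsey : ∀ r p q → ∃ λ N → ∀ {A : Set} {P : Pred (Vec A r) 0ℓ} → Decidable P → ∀ xs → N ≤ length xs →
  HomogeneousSublist P p xs ⊎ HomogeneousSublist (∁ P) q xs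
ramsey zero p q = p ⊔ q , go
  where
  go : ∀ {A : Set} {P : Pred (Vec A 0) 0ℓ} → Decidable P → ∀ xs → p ⊔ q ≤ length xs →
    HomogeneousSublist P p xs ⊎ HomogeneousSublist (∁ P) q xs
  go P? xs N≤ with P? []
  ... | yes P[] = inj₁ (xs , ⊆-refl , m⊔n≤o⇒m≤o p q N≤ , λ { [] _ → P[] })
  ... | no ¬P[] = inj₂ (xs , ⊆-refl , m⊔n≤o⇒n≤o p q N≤ , λ { [] _ → ¬P[] })
ramsey (suc r) zero    q       = 0 , λ _ xs _ → inj₁ ([] , minimum xs , z≤n , λ { (_ ∷ _) () })
ramsey (suc r) (suc p) zero    = 0 , λ _ xs _ → inj₂ ([] , minimum xs , z≤n , λ { (_ ∷ _) () })
ramsey (suc r) (suc p) (suc q)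
  with ramsey (suc r) p (suc q) | ramsey (suc r) (suc p) q
... | N₁ , R₁ | N₂ , R₂ with ramsey r N₁ N₂
... | N , R = suc N , go
  where
  go : ∀ {A : Set} {P : Pred (Vec A (suc r)) 0ℓ} → Decidable P → ∀ xs → suc N ≤ length xs →
    HomogeneousSublist P (suc p) xs ⊎ HomogeneousSublist (∁ P) (suc q) xs
  go P? (x ∷ xs) (s≤s N≤) with R (P? ∘ (x ∷_)) xs N≤
  ... | inj₁ (ys , ys⊆xs , N₁≤ , homₓ) with R₁ P? ys N₁≤
  ...   | inj₁ (zs , zs⊆ys , p≤ , hom) = inj₁
    (x ∷ zs , refl ∷ ⊆-trans zs⊆ys ys⊆xs , s≤s p≤ , homogeneous-∷ (homogeneous-⊆ zs⊆ys homₓ) hom)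
  ...   | inj₂ (zs , zs⊆ys , q< , hom) = inj₂ (zs , x ∷ʳ ⊆-trans zs⊆ys ys⊆xs , q< , hom)
  go P? (x ∷ xs) (s≤s N≤) | inj₂ (ys , ys⊆xs , N₂≤ , homₓ) with R₂ P? ys N₂≤
  ...   | inj₁ (zs , zs⊆ys , p< , hom) = inj₁ (zs , x ∷ʳ ⊆-trans zs⊆ys ys⊆xs , p< , hom)
  ...   | inj₂ (zs , zs⊆ys , q≤ , hom) = inj₂
    (x ∷ zs , refl ∷ ⊆-trans zs⊆ys ys⊆xs , s≤s q≤ , homogeneous-∷ (homogeneous-⊆ zs⊆ys homₓ) hom)

-- The two-colourings are treated one at a time. Whichever colour wins for `b`, the surviving list
-- must suffice for the rest, hence `ramsey r N′ N′`; homogeneity for `b` is inherited by the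
-- sublists chosen later.
ramsey-family : ∀ {B : Set} (bs : List B) r m → ∃ λ N →
  ∀ {A : Set} {P : B → Pred (Vec A r) 0ℓ} → (∀ b → Decidable (P b)) → ∀ xs → N ≤ length xs →
  ∃ λ ys → ys ⊆ xs × m ≤ length ys × All (λ b → Homogeneous (P b) ys ⊎ Homogeneous (∁ (P b)) ys) bs
ramsey-family []       r m = m , λ _ xs N≤ → xs , ⊆-refl , N≤ , []
ramsey-family (b ∷ bs) r m with ramsey-family bs r m
... | N′ , R′ with ramsey r N′ N′
... | N , R = N , go
  where
  go : ∀ {A : Set} {P : _ → Pred (Vec A r) 0ℓ} → (∀ b → Decidable (P b)) → ∀ xs → N ≤ length xs →
    ∃ λ ys → ys ⊆ xs × m ≤ length ys × All (λ b → Homogeneous (P b) ys ⊎ Homogeneous (∁ (P b)) ys) (b ∷ bs)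
  go P? xs N≤ with R (P? b) xs N≤
  go P? xs N≤ | inj₁ (ys , ys⊆xs , N′≤ , hom) with R′ P? ys N′≤
  ... | zs , zs⊆ys , m≤ , homs = zs , ⊆-trans zs⊆ys ys⊆xs , m≤ , inj₁ (homogeneous-⊆ zs⊆ys hom) ∷ homs
  go P? xs N≤ | inj₂ (ys , ys⊆xs , N′≤ , hom) with R′ P? ys N′≤
  ... | zs , zs⊆ys , m≤ , homs = zs , ⊆-trans zs⊆ys ys⊆xs , m≤ , inj₂ (homogeneous-⊆ zs⊆ys hom) ∷ homs

-- Patterns and orderings

Increasing : ∀ {m n} → Pred (Vec (Fin n) m) 0ℓ
Increasing v = ∀ i j → i <ᶠ j → lookup v i <ᶠ lookup v j

module _ {m n} (v : Vec (Fin n) m) (v↑ : Increasing v) where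

  increasing-reflects : ∀ i j → lookup v i <ᶠ lookup v j → i <ᶠ j
  increasing-reflects i j vᵢ<vⱼ with Fin.<-cmp i j
  ... | tri< i<j _ _  = i<j
  ... | tri≈ _ refl _ = contradiction vᵢ<vⱼ (ℕ.<-irrefl refl)
  ... | tri> _ _ j<i  = contradiction vᵢ<vⱼ (ℕ.<-asym (v↑ j i j<i))

  increasing⇒unique : Unique v
  increasing⇒unique = injective⇒unique λ {i} {j} vᵢ≡vⱼ → injective i j vᵢ≡vⱼ
    where
    injective : ∀ i j → lookup v i ≡ lookup v j → i ≡ j
    injective i j vᵢ≡vⱼ with Fin.<-cmp i j
    ... | tri< i<j _ _ = contradiction (cong toℕ vᵢ≡vⱼ) (ℕ.<⇒≢ (v↑ i j i<j))
    ... | tri≈ _ i≡j _ = i≡j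
    ... | tri> _ _ j<i = contradiction (cong toℕ (sym vᵢ≡vⱼ)) (ℕ.<⇒≢ (v↑ j i j<i))

monotone⇒inflationary : ∀ {m n} {f : Fin m → Fin n} → (∀ i j → i <ᶠ j → f i <ᶠ f j) →
  ∀ i → toℕ i ≤ toℕ (f i)
monotone⇒inflationary {suc m} {n} {f} mono = <-weakInduction _ z≤n λ i i≤fi → begin
  suc (toℕ i)               ≡⟨ cong suc (toℕ-inject₁ i) ⟨
  suc (toℕ (inject₁ i))     ≤⟨ s≤s i≤fi ⟩
  suc (toℕ (f (inject₁ i))) ≤⟨ mono (inject₁ i) (suc i) (s≤s (≤-reflexive (toℕ-inject₁ i))) ⟩
  toℕ (f (suc i))           ∎
  where open ≤-Reasoning

match-sym : ∀ {m n s} {a : Vec (Fin m) s} {b : Vec (Fin n) s} → PatternMatch a b → PatternMatch b a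
match-sym a~b i j i<j = ⇔-sym (a~b i j i<j)

match-trans : ∀ {l m n s} {a : Vec (Fin l) s} {b : Vec (Fin m) s} {c : Vec (Fin n) s} →
  PatternMatch a b → PatternMatch b c → PatternMatch a c
match-trans a~b b~c i j i<j = b~c i j i<j ⇔-∘ a~b i j i<j

-- `PatternMatch` speaks only of `i < j`. For `j < i` it excludes the reversed order in `b`, and
-- injectivity excludes equality.
match⇒monotone : ∀ {m n s} {a : Vec (Fin m) s} {b : Vec (Fin n) s} → Injective _≡_ _≡_ (lookup b) →
  PatternMatch a b → ∀ i j → lookup a i <ᶠ lookup a j → lookup b i <ᶠ lookup b j
match⇒monotone {b = b} b-inj a~b i j aᵢ<aⱼ with Fin.<-cmp i j
... | tri< i<j _ _  = to (a~b i j i<j) aᵢ<aⱼ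
... | tri≈ _ refl _ = contradiction aᵢ<aⱼ (ℕ.<-irrefl refl)
... | tri> _ i≢j j<i with Fin.<-cmp (lookup b i) (lookup b j)
...   | tri< bᵢ<bⱼ _ _ = bᵢ<bⱼ
...   | tri≈ _ bᵢ≡bⱼ _ = contradiction (b-inj bᵢ≡bⱼ) i≢j
...   | tri> _ _ bⱼ<bᵢ = contradiction aᵢ<aⱼ (ℕ.<-asym (from (a~b j i j<i) bⱼ<bᵢ))

-- `q ∘ p⁻¹` is a strictly increasing self-map of `Fin r`, hence inflationary. With the roles of `p`
-- and `q` exchanged this shows that a permutation is determined by its pattern.
match⇒≤ : ∀ {r} (p q : Perm r) → PatternMatch (value p) (value q) →
  ∀ i → toℕ (lookup (value p) i) ≤ toℕ (lookup (value q) i)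
match⇒≤ {r} p q p~q i = subst (λ k → toℕ (lookup (value p) i) ≤ toℕ (lookup (value q) k))
  (perm-injective p (proj₂ (perm-surjective p _)))
  (monotone⇒inflationary {f = q∘p⁻¹} mono (lookup (value p) i))
  where
  p⁻¹ q∘p⁻¹ : Fin r → Fin r
  p⁻¹ y = proj₁ (perm-surjective p y)
  q∘p⁻¹ = lookup (value q) ∘ p⁻¹
  mono : ∀ x y → x <ᶠ y → q∘p⁻¹ x <ᶠ q∘p⁻¹ y
  mono x y x<y = match⇒monotone {a = value p} {value q} (perm-injective q) p~q (p⁻¹ x) (p⁻¹ y)
    (subst₂ _<ᶠ_ (sym (proj₂ (perm-surjective p x))) (sym (proj₂ (perm-surjective p y))) x<y)

match⇒≡ : ∀ {r} (p q : Perm r) → PatternMatch (value p) (value q) → p ≡ q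
match⇒≡ p q p~q = value-injective (vec-ext λ i → toℕ-injective (≤-antisym
  (match⇒≤ p q p~q i) (match⇒≤ q p (match-sym {a = value p} {value q} p~q) i)))

∈⇒lookup : ∀ {A : Set} {n x} {v : Vec A n} → x ∈ᵛ v → ∃ λ i → lookup v i ≡ x
∈⇒lookup x∈v = Anyᵛ.index x∈v , sym (Anyᵛ.lookup-index x∈v)

module _ {A : Set} {r : ℕ} where

  -- For increasing `zs` this is the ordering of its entries that has pattern `p`. Fixing `zs` thus
  -- identifies the orderings of an r-set with `Perm r`.
  arrange : Vec A r → Perm r → Vec A r
  arrange zs p = Vec.map (lookup zs) (value p)

  lookup-arrange : ∀ zs p i → lookup (arrange zs p) i ≡ lookup zs (lookup (value p) i)
  lookup-arrange zs p i = lookup-map i (lookup zs) (value p)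

  arrange-unique : ∀ {zs} p → Unique zs → Unique (arrange zs p)
  arrange-unique p zs! = Uniqueᵛ.map⁺ (unique⇒injective zs!) (perm-unique p)

  arrange-injective : ∀ {zs} → Unique zs → Injective _≡_ _≡_ (arrange zs)
  arrange-injective zs! eq = value-injective (map-injective (unique⇒injective zs!) eq)

  ∈-arrange : ∀ {zs} p x → x ∈ᵛ arrange zs p ⇔ x ∈ᵛ zs
  ∈-arrange {zs} p x = mk⇔ forth back
    where
    forth : x ∈ᵛ arrange zs p → x ∈ᵛ zs
    forth x∈ with ∈⇒lookup x∈
    ... | i , refl = subst (_∈ᵛ zs) (sym (lookup-arrange zs p i)) (∈ᵛ.∈-lookup _ zs)
    back : x ∈ᵛ zs → x ∈ᵛ arrange zs p
    back x∈ with ∈⇒lookup x∈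
    ... | j , refl with perm-surjective p j
    ...   | i , refl = subst (_∈ᵛ arrange zs p) (lookup-arrange zs p i) (∈ᵛ.∈-lookup i _)

  arrangement : ∀ zs {v : Vec A r} → Unique v → (∀ x → x ∈ᵛ v → x ∈ᵛ zs) → ∃ λ p → arrange zs p ≡ v
  arrangement zs {v} v! v⊆zs =
    (tabulate position ,ʳ [ Uniqueᵛ.tabulate⁺ position-injective ]) , vec-ext λ i → begin
      lookup (Vec.map (lookup zs) (tabulate position)) i ≡⟨ lookup-map i (lookup zs) (tabulate position) ⟩
      lookup zs (lookup (tabulate position) i)           ≡⟨ cong (lookup zs) (lookup∘tabulate position i) ⟩
      lookup zs (position i)                             ≡⟨ lookup-position i ⟩
      lookup v i                                         ∎
    where
    open ≡-Reasoning
    position : Fin r → Fin r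
    position i = proj₁ (∈⇒lookup (v⊆zs _ (∈ᵛ.∈-lookup i v)))
    lookup-position : ∀ i → lookup zs (position i) ≡ lookup v i
    lookup-position i = proj₂ (∈⇒lookup (v⊆zs _ (∈ᵛ.∈-lookup i v)))
    position-injective : ∀ {i j} → position i ≡ position j → i ≡ j
    position-injective {i} {j} eq = Uniqueᵛ.lookup-injective v! i j
      (trans (sym (lookup-position i)) (trans (cong (lookup zs) eq) (lookup-position j)))

arrange-match : ∀ {n r} (zs : Vec (Fin n) r) → Increasing zs → ∀ p → PatternMatch (arrange zs p) (value p)
arrange-match zs zs↑ p i j _ =
  subst₂ (λ x y → x <ᶠ y ⇔ _) (sym (lookup-arrange zs p i)) (sym (lookup-arrange zs p j))
    (mk⇔ (increasing-reflects zs zs↑ _ _) (zs↑ _ _))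

-- Counting the orderings of an r-set

_Enumerates_ : ∀ {n m} → Vec (Fin n) m → Subset n → Set
zs Enumerates S = ∀ x → x ∈ᵛ zs ⇔ x ∈ˢ S

-- Moves the count from orderings of `S` to permutations. It serves both ways: to show that a
-- pattern digraph is a tournament, and to count the edge patterns of a given tournament on one
-- r-set.
exactly-orderings : ∀ {n r} {S : Subset n} {zs : Vec (Fin n) r} → Unique zs →
  zs Enumerates S → ∀ {Q : Pred (Vec (Fin n) r) 0ℓ} {ps} → List.Unique ps →
  (∀ p → p ∈ ps ⇔ Q (arrange zs p)) → Exactly (length ps) (λ v → IsOrderingOf S v × Q v)
exactly-orderings {S = S} {zs} zs! zs⇔S {Q} {ps} ps! ps⇔Q =
  List.map (arrange zs) ps , Uniqueₗ.map⁺ (arrange-injective zs!) ps! , length-map (arrange zs) ps ,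
  λ v → mk⇔ forth back
  where
  forth : ∀ {v} → v ∈ List.map (arrange zs) ps → IsOrderingOf S v × Q v
  forth v∈ with ∈-map⁻ (arrange zs) v∈
  ... | p , p∈ps , refl =
    (arrange-unique p zs! , λ x → zs⇔S x ⇔-∘ ∈-arrange p x) , to (ps⇔Q p) p∈ps
  back : ∀ {v} → IsOrderingOf S v × Q v → v ∈ List.map (arrange zs) ps
  back ((v! , v⇔S) , Qv) with arrangement zs v! (λ x → from (zs⇔S x) ∘ to (v⇔S x))
  ... | p , refl = ∈-map⁺ (arrange zs) (from (ps⇔Q p) Qv)

members : ∀ {n} (S : Subset n) → Vec (Fin n) ∣ S ∣
members []            = []
members (inside  ∷ S) = zero ∷ Vec.map suc (members S)
members (outside ∷ S) = Vec.map suc (members S)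

map-suc-increasing : ∀ {m n} (v : Vec (Fin n) m) → Increasing v → Increasing (Vec.map suc v)
map-suc-increasing v v↑ i j i<j =
  subst₂ _<ᶠ_ (sym (lookup-map i suc v)) (sym (lookup-map j suc v)) (s≤s (v↑ i j i<j))

members-increasing : ∀ {n} (S : Subset n) → Increasing (members S)
members-increasing (inside  ∷ S) zero    (suc j) _         =
  subst (λ x → 0 < toℕ x) (sym (lookup-map j suc (members S))) (s≤s z≤n)
members-increasing (inside  ∷ S) (suc i) (suc j) (s≤s i<j) =
  map-suc-increasing (members S) (members-increasing S) i j i<j
members-increasing (outside ∷ S) i       j       i<j       =
  map-suc-increasing (members S) (members-increasing S) i j i<j

members-enumerates : ∀ {n} (S : Subset n) → members S Enumerates S
members-enumerates S x = mk⇔ (λ x∈ → sound S x∈) (complete′ S)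
  where
  sound : ∀ {n} (S : Subset n) {x} → x ∈ᵛ members S → x ∈ˢ S
  sound-suc : ∀ {n} (S : Subset n) {x} → x ∈ᵛ Vec.map suc (members S) → ∀ {b} → x ∈ˢ b ∷ S
  sound (inside  ∷ S) (Anyᵛ.here refl) = here
  sound (inside  ∷ S) (Anyᵛ.there x∈)  = sound-suc S x∈
  sound (outside ∷ S) x∈               = sound-suc S x∈
  sound-suc S x∈ with ∈⇒lookup x∈
  ... | i , refl = subst (_∈ˢ (_ ∷ S)) (sym (lookup-map i suc (members S))) (there (sound S (∈ᵛ.∈-lookup i _)))
  complete′ : ∀ {n} (S : Subset n) {x} → x ∈ˢ S → x ∈ᵛ members S
  complete′ (inside  ∷ S) here       = Anyᵛ.here refl
  complete′ (inside  ∷ S) (there x∈) = Anyᵛ.there (∈ᵛ.∈-map⁺ suc (complete′ S x∈))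
  complete′ (outside ∷ S) (there x∈) = ∈ᵛ.∈-map⁺ suc (complete′ S x∈)

module _ {n r} (zs : Vec (Fin n) r) where
  open DecMembershipᵛ (Fin._≟_ {n}) using (_∈?_)

  range : Subset n
  range = tabulate λ x → does (x ∈? zs)

  range-enumerated : zs Enumerates range
  range-enumerated x = mk⇔
    (λ x∈zs → lookup⇒[]= x range (trans (lookup∘tabulate _ x) (dec-true (x ∈? zs) x∈zs)))
    (λ x∈ → does-true (x ∈? zs) (trans (sym (lookup∘tabulate _ x)) ([]=⇒lookup x∈)))
    where
    does-true : ∀ {P : Set} (P? : Dec P) → does P? ≡ true → P
    does-true (yes p) _ = p

  -- `zs` and `members range` are duplicate-free lists of the same set, so the length of each bounds
  -- that of the other.
  ∣range∣ : Unique zs → ∣ range ∣ ≡ r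
  ∣range∣ zs! = ≤-antisym
    (covered⇒≤ (lookup zs) (unique⇒injective (increasing⇒unique (members range) (members-increasing range))) λ i →
      ∈⇒lookup (from (range-enumerated _) (to (members-enumerates range _) (∈ᵛ.∈-lookup i _))))
    (covered⇒≤ (lookup (members range)) (unique⇒injective zs!) λ i →
      ∈⇒lookup (from (members-enumerates range _) (to (range-enumerated _) (∈ᵛ.∈-lookup i _))))

-- The pattern digraph and its tight paths

match? : ∀ {m n s} (a : Vec (Fin m) s) (b : Vec (Fin n) s) → Dec (PatternMatch a b)
match? a b = Fin.all? λ i → Fin.all? λ j → i Fin.<? j →-dec
  map′ (λ (f , g) → mk⇔ f g) (λ e → to e , from e)
    ((lookup a i Fin.<? lookup a j →-dec lookup b i Fin.<? lookup b j) ×-dec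
     (lookup b i Fin.<? lookup b j →-dec lookup a i Fin.<? lookup a j))

patternDigraph : ∀ {r} → List (Perm r) → ∀ n → RDigraph r n
patternDigraph ps n = record
  { E        = λ v → Unique v × ∃ λ p → p ∈ ps × PatternMatch v (value p)
  ; E?       = λ v → unique? Fin._≟_ v ×-dec
      map′ find (λ (p , p∈ , v~p) → lose p∈ v~p) (Any.any? (λ p → match? v (value p)) ps)
  ; distinct = proj₁
  }

-- Every r-set has precisely one ordering of each pattern, the arrangement of its increasing list,
-- so its edges correspond to the members of `ps`.
patternDigraph-tournament : ∀ {r n} {ps : List (Perm r)} → List.Unique ps →
  IsTournament (length ps) (patternDigraph ps n)
patternDigraph-tournament {n = n} {ps} ps! S refl = exactly-orderings zs! (members-enumerates S) ps! λ p → mk⇔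
  (λ p∈ps → arrange-unique p zs! , p , p∈ps , arrange-match zs zs↑ p)
  (λ (_ , q , q∈ps , zsₚ~q) → subst (_∈ ps) (sym (match⇒≡ p q
    (match-trans {a = value p} {arrange zs p} {value q}
      (match-sym {a = arrange zs p} {value p} (arrange-match zs zs↑ p)) zsₚ~q))) q∈ps)
  where
  zs : Vec (Fin n) ∣ S ∣
  zs = members S
  zs↑ : Increasing zs
  zs↑ = members-increasing S
  zs! : Unique zs
  zs! = increasing⇒unique zs zs↑

linked-tabulate : ∀ {A : Set} {R : Rel A 0ℓ} {t} {f : Fin t → A} →
  (∀ i j → toℕ j ≡ suc (toℕ i) → R (f i) (f j)) → Linked R (tabulate f)
linked-tabulate {t = zero}        step = []
linked-tabulate {t = suc zero}    step = [-]
linked-tabulate {t = suc (suc t)} step =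
  step zero (suc zero) refl ∷ linked-tabulate λ i j eq → step (suc i) (suc j) (cong suc eq)

lookup-tail : ∀ {A : Set} {n} (v : Vec A (suc n)) i → lookup (tail v) i ≡ lookup v (suc i)
lookup-tail (_ ∷ _) _ = refl

lookup-init : ∀ {A : Set} {n} (v : Vec A (suc n)) i → lookup (init v) i ≡ lookup v (inject₁ i)
lookup-init (_ ∷ _ ∷ _) zero    = refl
lookup-init (_ ∷ v@(_ ∷ _)) (suc i) = lookup-init v i

match-tail : ∀ {m n s} {a : Vec (Fin m) (suc s)} {b : Vec (Fin n) (suc s)} →
  PatternMatch a b → PatternMatch (tail a) (tail b)
match-tail {a = _ ∷ _} {_ ∷ _} a~b i j i<j = a~b (suc i) (suc j) (s≤s i<j)

match-init : ∀ {m n s} {a : Vec (Fin m) (suc s)} {b : Vec (Fin n) (suc s)} →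
  PatternMatch a b → PatternMatch (init a) (init b)
match-init {a = a} {b} a~b i j i<j
  rewrite lookup-init a i | lookup-init a j | lookup-init b i | lookup-init b j =
  a~b (inject₁ i) (inject₁ j) (subst₂ _<_ (sym (toℕ-inject₁ i)) (sym (toℕ-inject₁ j)) i<j)

-- Dropping the first vertex of one window and the last vertex of the next leaves the same list. The
-- patterns of the two windows both match it there, which is adjacency in `PSG`.
path⇒walk : ∀ {r n s t} {ps : List (Perm (suc r))} → t + r ≤ s →
  patternDigraph ps n Contains tightPath (suc r) s → Walk (induced (PSG (suc r)) ps) t
path⇒walk {r} {n} {s} {t} {ps} t+r≤s (φ , _ , edge) = tabulate vertex , linked-tabulate step
  where
  bound : ∀ (i : Fin t) (j : Fin (suc r)) → toℕ i + toℕ j < s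
  bound i j = <-≤-trans (+-mono-<-≤ (toℕ<n i) (toℕ≤pred[n] j)) t+r≤s
  window : Fin t → Vec (Fin s) (suc r)
  window i = tabulate λ j → fromℕ< (bound i j)
  lookup-window : ∀ i j → toℕ (lookup (window i) j) ≡ toℕ i + toℕ j
  lookup-window i j = trans (cong toℕ (lookup∘tabulate (λ j → fromℕ< (bound i j)) j)) (toℕ-fromℕ< (bound i j))
  window-edge : ∀ i → E (patternDigraph ps n) (Vec.map φ (window i))
  -- There are `suc s ∸ suc r`, that is `s ∸ r`, starting positions, and `t + r ≤ s` makes this at
  -- least `t`.
  window-edge i = edge (inject≤ i (m+n≤o⇒m≤o∸n t t+r≤s) , λ j →
    trans (lookup-window i j) (cong (_+ toℕ j) (sym (toℕ-inject≤ i _))))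
  vertex : Fin t → ∃ λ p → p ∈ ps
  vertex i with window-edge i
  ... | _ , p , p∈ps , _ = p , p∈ps
  vertex-match : ∀ i → PatternMatch (Vec.map φ (window i)) (value (proj₁ (vertex i)))
  vertex-match i with window-edge i
  ... | _ , p , p∈ps , v~p = v~p
  shared : ∀ i j → toℕ j ≡ suc (toℕ i) → tail (Vec.map φ (window i)) ≡ init (Vec.map φ (window j))
  shared i j j≡1+i = vec-ext λ k → begin
    lookup (tail (Vec.map φ (window i))) k        ≡⟨ lookup-tail (Vec.map φ (window i)) k ⟩
    lookup (Vec.map φ (window i)) (suc k)         ≡⟨ lookup-map (suc k) φ (window i) ⟩
    φ (lookup (window i) (suc k))                 ≡⟨ cong φ (toℕ-injective (toℕ-eq k)) ⟩
    φ (lookup (window j) (inject₁ k))             ≡⟨ lookup-map (inject₁ k) φ (window j) ⟨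
    lookup (Vec.map φ (window j)) (inject₁ k)     ≡⟨ lookup-init (Vec.map φ (window j)) k ⟨
    lookup (init (Vec.map φ (window j))) k        ∎
    where
    open ≡-Reasoning
    toℕ-eq : ∀ k → toℕ (lookup (window i) (suc k)) ≡ toℕ (lookup (window j) (inject₁ k))
    toℕ-eq k = begin
      toℕ (lookup (window i) (suc k))      ≡⟨ lookup-window i (suc k) ⟩
      toℕ i + suc (toℕ k)                  ≡⟨ +-suc (toℕ i) (toℕ k) ⟩
      suc (toℕ i) + toℕ k                  ≡⟨ cong₂ _+_ j≡1+i (toℕ-inject₁ k) ⟨
      toℕ j + toℕ (inject₁ k)              ≡⟨ lookup-window j (inject₁ k) ⟨
      toℕ (lookup (window j) (inject₁ k))  ∎
  step : ∀ i j → toℕ j ≡ suc (toℕ i) →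
    PatternMatch (tail (value (proj₁ (vertex i)))) (init (value (proj₁ (vertex j))))
  step i j j≡1+i = match-trans {a = tail pᵢ} {tail wᵢ} {init pⱼ}
    (match-sym {a = tail wᵢ} {tail pᵢ} (match-tail {a = wᵢ} {pᵢ} (vertex-match i)))
    (subst (λ w → PatternMatch w (init pⱼ)) (sym (shared i j j≡1+i))
      (match-init {a = wⱼ} {pⱼ} (vertex-match j)))
    where
    pᵢ = value (proj₁ (vertex i))
    pⱼ = value (proj₁ (vertex j))
    wᵢ = Vec.map φ (window i)
    wⱼ = Vec.map φ (window j)

-- Existence of f and a_t

module _ {r n : ℕ} where

  _≅_ : RDigraph r n → RDigraph r n → Set
  G ≅ H = ∀ v → E G v ⇔ E H v

  tournament-resp : ∀ {k G H} → G ≅ H → IsTournament k G → IsTournament k H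
  tournament-resp G≅H tour S ∣S∣≡r = exactly-resp
    (λ v → mk⇔ (λ (ord , e) → ord , to (G≅H v) e) (λ (ord , e) → ord , from (G≅H v) e)) (tour S ∣S∣≡r)

  contains-resp : ∀ {s G H} {P : RDigraph r s} → G ≅ H → G Contains P → H Contains P
  contains-resp G≅H (φ , φ-inj , edge) = φ , φ-inj , to (G≅H _) ∘ edge

  -- RDigraph r n lies in Set₁ and is not enumerable; up to _≅_ its elements are
  -- given by bit vectors, which makes the quantifier in f a finite one.
  Code : Set
  Code = Vec Bool (length (elements {Vec (Fin n) r}))

  -- A bit may be set at a list with repeated entries; the factor `Unique v` discards it, so every
  -- code yields a digraph.
  decode : Code → RDigraph r n
  decode c = record
    { E        = λ v → T (lookup c (Any.index (complete v))) × Unique v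
    ; E?       = λ v → T? _ ×-dec unique? Fin._≟_ v
    ; distinct = proj₂
    }

  encode : RDigraph r n → Code
  encode G = tabulate λ i → isYes (E? G (List.lookup elements i))

  decode∘encode : ∀ G → decode (encode G) ≅ G
  decode∘encode G v = mk⇔
    (λ (Tv , _) → toWitness (subst T (bit v) Tv))
    (λ e → subst T (sym (bit v)) (fromWitness e) , distinct G e)
    where
    bit : ∀ v → lookup (encode G) (Any.index (complete v)) ≡ isYes (E? G v)
    bit v = trans
      (lookup∘tabulate (λ i → isYes (E? G (List.lookup elements i))) (Any.index (complete v)))
      (cong (isYes ∘ E? G) (sym (lookup-index (complete v))))

  tournament? : ∀ k (G : RDigraph r n) → Dec (IsTournament k G)
  tournament? k G = ∀? λ S → (∣ S ∣ ℕ.≟ r) →-dec exactly? (Vec.≡-dec Fin._≟_)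
    (λ v → (unique? Fin._≟_ v ×-dec orderings? S v) ×-dec E? G v) k
    where
    open DecMembershipᵛ (Fin._≟_ {n}) using () renaming (_∈?_ to _∈ᵛ?_)
    orderings? : ∀ S (v : Vec (Fin n) r) → Dec (∀ x → _ ⇔ _)
    orderings? S v = Fin.all? λ x → map′ (λ (f , g) → mk⇔ f g) (λ e → to e , from e)
      (((x ∈ᵛ? v) →-dec (x Subset.∈? S)) ×-dec ((x Subset.∈? S) →-dec (x ∈ᵛ? v)))

  contains? : ∀ {s} (G : RDigraph r n) (P : RDigraph r s) → Dec (G Contains P)
  contains? {s} G P = map′ forth back (∃? λ v → embedding? v)
    where
    Embedding : (Fin s → Fin n) → Set
    Embedding φ = (∀ i j → φ i ≡ φ j → i ≡ j) × (∀ v → E P v → E G (Vec.map φ v))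
    embedding? : ∀ v → Dec (Embedding (lookup v))
    embedding? v = Fin.all? (λ i → Fin.all? λ j → (lookup v i Fin.≟ lookup v j) →-dec (i Fin.≟ j))
      ×-dec ∀? (λ u → E? P u →-dec E? G (Vec.map (lookup v) u))
    forth : ∃ (Embedding ∘ lookup) → G Contains P
    forth (v , inj , edge) = lookup v , inj _ _ , edge _
    back : G Contains P → ∃ (Embedding ∘ lookup)
    back (φ , φ-inj , edge) = tabulate φ
      , (λ i j eq → φ-inj (trans (sym (lookup∘tabulate φ i)) (trans eq (lookup∘tabulate φ j))))
      , λ u e → subst (E G) (map-cong (sym ∘ lookup∘tabulate φ) u) (edge e)

  forced? : ∀ k s → Dec (∀ (G : RDigraph r n) → IsTournament k G → G Contains tightPath r s)
  forced? k s = map′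
    (λ ∀c G tour → contains-resp {G = decode (encode G)} {G} {tightPath r s} (decode∘encode G) (∀c (encode G)
      (tournament-resp {G = G} {decode (encode G)} (λ v → ⇔-sym (decode∘encode G v)) tour)))
    (λ ∀G → ∀G ∘ decode)
    (∀? λ c → tournament? k (decode c) →-dec contains? (decode c) (tightPath r s))

length-take-≤ : ∀ {A : Set} {k} (xs : List A) → k ≤ length xs → length (take k xs) ≡ k
length-take-≤ {k = k} xs k≤ = trans (length-take k xs) (m≤n⇒m⊓n≡m k≤)

somePerms : ∀ r k → k ≤ r ! → ∃ λ (ps : List (Perm r)) → List.Unique ps × length ps ≡ k
somePerms r k k≤r! = take k (allPerms r) , Uniqueₗ.take⁺ k (allPerms-unique r)
  , length-take-≤ (allPerms r) (subst (k ≤_) (sym (length-allPerms r)) k≤r!)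

-- The hypothesis on `k` supplies a tournament, namely a pattern digraph, and embedding a forced
-- path into it gives `s ≤ n`. With no tournament at all every `s` would be forced vacuously and
-- there would be no maximum.
f-defined : ∀ {r n k} → k ≤ suc r ! → ∃ f[ n , suc r , k ]≡_
f-defined {r} {n} {k} k≤r! = greatest (forced? k) empty-path n bounded
  where
  empty-path : ∀ (G : RDigraph (suc r) n) → IsTournament k G → G Contains tightPath (suc r) 0
  -- On no vertices the number of windows is `suc 0 ∸ suc r`, which is zero.
  empty-path G _ = (λ ()) , (λ { {()} }) , λ (i , _) → ⊥-elim (Fin.¬Fin0 (subst Fin (0∸n≡0 r) i))
  bounded : ∀ s → (∀ (G : RDigraph (suc r) n) → IsTournament k G → G Contains tightPath (suc r) s) → s ≤ n
  bounded s forced with somePerms (suc r) k k≤r!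
  ... | ps , ps! , refl with forced (patternDigraph ps n) (patternDigraph-tournament ps!)
  ...   | _ , φ-inj , _ = injective⇒≤ φ-inj

walk? : ∀ {r} (ps : List (Perm (suc r))) t → Dec (Walk (induced (PSG (suc r)) ps) t)
walk? ps t = ∃? (linked? λ p q → match? (tail (value (proj₁ p))) (init (value (proj₁ q))))

walk-⊆ : ∀ {r t} {ps qs : List (Perm (suc r))} → (∀ {p} → p ∈ ps → p ∈ qs) →
  Walk (induced (PSG (suc r)) ps) t → Walk (induced (PSG (suc r)) qs) t
walk-⊆ ps⊆qs (ws , linked) = Vec.map (λ (p , p∈) → p , ps⊆qs p∈) ws , Linked.map⁺ linked

idPerm : ∀ {r} → Perm r
idPerm = tabulate id ,ʳ [ Uniqueᵛ.tabulate⁺ id ]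

idPerm-loop : ∀ {r} → Digraph._⟶_ (PSG (suc r)) idPerm idPerm
idPerm-loop {r} i j i<j
  rewrite lookup-tail (tabulate {n = suc r} id) i | lookup-tail (tabulate {n = suc r} id) j
        | lookup-init (tabulate {n = suc r} id) i | lookup-init (tabulate {n = suc r} id) j
        | lookup∘tabulate {n = suc r} id (suc i) | lookup∘tabulate {n = suc r} id (suc j)
        | lookup∘tabulate {n = suc r} id (inject₁ i) | lookup∘tabulate {n = suc r} id (inject₁ j)
        | toℕ-inject₁ i | toℕ-inject₁ j =
  mk⇔ (λ _ → i<j) (λ _ → s≤s i<j)

linked-replicate : ∀ {A : Set} {R : A → A → Set} {x} → R x x → ∀ t → Linked R (Vec.replicate t x)
linked-replicate Rxx zero          = []
linked-replicate Rxx (suc zero)    = [-]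
linked-replicate Rxx (suc (suc t)) = Rxx ∷ linked-replicate Rxx (suc t)

-- Repeating the loop at `idPerm` gives walks of every size, so `idPerm` is missing from `ps` and
-- can be added to it without exceeding the list of all permutations.
walkless⇒length< : ∀ {r t} {ps : List (Perm (suc r))} → List.Unique ps →
  ¬ Walk (induced (PSG (suc r)) ps) t → length ps < suc r !
walkless⇒length< {r} {t} {ps} ps! walkless = subst (suc (length ps) ≤_) (length-allPerms (suc r))
  (unique-⊆⇒length≤ (All.tabulate id∉ ∷ ps!) λ _ → allPerms-complete _)
  where
  id∉ : ∀ {p} → p ∈ ps → idPerm ≢ p
  id∉ p∈ refl = walkless (Vec.replicate t (idPerm , p∈) , linked-replicate idPerm-loop t)

-- Vertex sets of size `m` are searched among the finitely many vectors of length `m`. The empty set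
-- starts the search because a walk of size `suc t` has a first vertex.
a-defined : ∀ r t → ∃ a[ suc t , PSG (suc r) ]≡_
a-defined r t = greatest walkless? ([] , [] , refl , λ { ((() ∷ _) , _) }) (suc r !)
  λ { _ (ps , ps! , refl , walkless) → <⇒≤ (walkless⇒length< ps! walkless) }
  where
  walkless? : ∀ m → Dec (Σ (List (Perm (suc r))) λ ps →
    List.Unique ps × length ps ≡ m × ¬ Walk (induced (PSG (suc r)) ps) (suc t))
  walkless? m = map′
    (λ (v , v! , walkless) → toList v , v! , length-toList v , walkless)
    (λ { (ps , ps! , refl , walkless) → fromList ps
       , subst (λ qs → List.Unique qs × ¬ Walk (induced (PSG (suc r)) qs) (suc t))
           (sym (toList∘fromList ps)) (ps! , walkless) })
    (∃? λ v → DecUnique.unique? _≟ᵖ_ (toList v) ×-dec ¬? (walk? (toList v) (suc t)))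

-- Realizing walks

-- One more than the maximum of `f` on `D`, and 0 when `D` is empty; the latter serves a new entry
-- that lies below all the entries it is compared with.
leastStrictBound : ∀ {m} {D : Pred (Fin m) 0ℓ} → Decidable D → (f : Fin m → ℕ) → ∃ λ y →
  (∀ j → D j → f j < y) × (∀ u → (∀ j → D j → f j < u) → y ≤ u)
leastStrictBound {zero}  D? f = 0 , (λ ()) , λ _ _ → z≤n
leastStrictBound {suc m} D? f with leastStrictBound (D? ∘ suc) (f ∘ suc) | D? zero
... | y , above , least | yes D₀ = suc (f zero) ⊔ y
  , (λ { zero _ → m≤m⊔n _ y ; (suc j) Dj → ≤-trans (above j Dj) (m≤n⊔m (suc (f zero)) y) })
  , λ u f<u → ⊔-lub (f<u zero D₀) (least u (f<u ∘ suc))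
... | y , above , least | no ¬D₀ = y
  , (λ { zero D₀ → contradiction D₀ ¬D₀ ; (suc j) → above j })
  , λ u f<u → least u (f<u ∘ suc)

-- One implication suffices: the pattern orders any two entries of a window, so the converse
-- follows. Positions are tied to window and offset by equations on `toℕ`, which lets overlapping
-- windows be compared without casts.
Realizes : ∀ {r t} → Vec (Perm (suc r)) t → (Fin (t + r) → ℕ) → Set
Realizes {r} {t} ws v = ∀ (i : Fin t) (x y : Fin (t + r)) (j k : Fin (suc r)) →
  toℕ x ≡ toℕ i + toℕ j → toℕ y ≡ toℕ i + toℕ k →
  lookup (value (lookup ws i)) j <ᶠ lookup (value (lookup ws i)) k → v x < v y

-- A single pattern uses the values below `suc r`. If the old values are below `B`, they become
-- `2 * suc v ≤ 2 * B` and the new one is `suc (2 * y)` with `y ≤ B`, all below `2 * suc B`.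
realizationBound : ℕ → ℕ → ℕ
realizationBound r zero    = suc r
realizationBound r (suc t) = 2 * suc (realizationBound r t)

Realization : ∀ {r t} → Vec (Perm (suc r)) (suc t) → Set
Realization {r} {t} ws = ∃ λ v → Injective _≡_ _≡_ v × (∀ x → v x < realizationBound r t) × Realizes ws v

odd<even : ∀ {m n} → m ≤ n → suc (2 * m) < 2 * suc n
odd<even {m} {n} m≤n rewrite *-suc 2 n = s≤s (s≤s (*-monoʳ-≤ 2 m≤n))

-- The values already chosen move to the positive even numbers, so that an odd
-- number is available in each of the gaps between them.
prepend : ∀ {r t} (w : Perm (suc r)) (ws : Vec (Perm (suc r)) (suc t)) →
  Digraph._⟶_ (PSG (suc r)) w (Vec.head ws) → Realization ws → Realization (w ∷ ws)
prepend {r} {t} w ws@(w′ ∷ _) w⟶w′ (v , v-inj , v< , realizes) = v′ , v′-inj , v′< , realizes′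
  where
  p : Fin (suc r) → Fin (suc r)
  p = lookup (value w)

  -- The order that `w` prescribes after its first entry is the order of the initial entries of
  -- `w′`, which `v` already realizes.
  ordered : ∀ j k → p (suc j) <ᶠ p (suc k) → ∀ x y → toℕ x ≡ toℕ j → toℕ y ≡ toℕ k → v x < v y
  ordered j k pⱼ<pₖ x y x≡j y≡k = realizes zero x y (inject₁ j) (inject₁ k)
    (trans x≡j (sym (toℕ-inject₁ j))) (trans y≡k (sym (toℕ-inject₁ k)))
    (subst₂ _<ᶠ_ (lookup-init (value w′) j) (lookup-init (value w′) k)
      (match⇒monotone {a = tail (value w)} {init (value w′)} init-inj w⟶w′ j k
        (subst₂ _<ᶠ_ (sym (lookup-tail (value w) j)) (sym (lookup-tail (value w) k)) pⱼ<pₖ)))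
    where
    init-inj : Injective _≡_ _≡_ (lookup (init (value w′)))
    init-inj {a} {b} eq = Fin.inject₁-injective (perm-injective w′
      (trans (sym (lookup-init (value w′) a)) (trans eq (lookup-init (value w′) b))))

  early : Fin r → Fin (suc t + r)
  early j = inject≤ j (m≤n+m r (suc t))

  -- Among the `r` entries shared with the next window, those that `w` places below its first entry
  -- must have values less than `y`.
  gap : ∃ λ y → (∀ j → p (suc j) <ᶠ p zero → v (early j) < y)
              × (∀ u → (∀ j → p (suc j) <ᶠ p zero → v (early j) < u) → y ≤ u)
  gap = leastStrictBound (λ j → p (suc j) Fin.<? p zero) (v ∘ early)
  y₀ : ℕ
  y₀ = proj₁ gap

  v′ : Fin (suc (suc t) + r) → ℕ
  v′ zero    = suc (2 * y₀)
  v′ (suc x) = 2 * suc (v x)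

  v′-inj : Injective _≡_ _≡_ v′
  v′-inj {zero}  {zero}  _  = refl
  v′-inj {zero}  {suc y} eq = contradiction (sym eq) (even≢odd (suc (v y)) y₀)
  v′-inj {suc x} {zero}  eq = contradiction eq (even≢odd (suc (v x)) y₀)
  v′-inj {suc x} {suc y} eq = cong suc (v-inj (ℕ.suc-injective (*-cancelˡ-≡ (suc (v x)) (suc (v y)) 2 eq)))

  v′< : ∀ x → v′ x < realizationBound r (suc t)
  v′< zero    = odd<even (proj₂ (proj₂ gap) _ λ j _ → v< (early j))
  v′< (suc x) = *-monoʳ-< 2 (s≤s (v< x))

  realizes′ : Realizes (w ∷ ws) v′
  realizes′ zero    zero    zero    zero    zero    _   _   p₀<p₀ = contradiction p₀<p₀ (ℕ.<-irrefl refl)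
  -- An entry above the new one exceeds every shared entry below the new one, so `v y` is itself a
  -- strict bound and the least one satisfies `y₀ ≤ v y`.
  realizes′ zero    zero    (suc y) zero    (suc k) _   y≡k p₀<pₖ = odd<even (proj₂ (proj₂ gap) (v y) λ j pⱼ<p₀ →
    ordered j k (<-trans pⱼ<p₀ p₀<pₖ) (early j) y (toℕ-inject≤ j _) (ℕ.suc-injective y≡k))
  realizes′ zero    (suc x) zero    (suc j) zero    x≡j _   pⱼ<p₀ = s≤s (*-monoʳ-≤ 2
    (subst (λ z → v z < y₀) (toℕ-injective (trans (toℕ-inject≤ j _) (sym (ℕ.suc-injective x≡j))))
      (proj₁ (proj₂ gap) j pⱼ<p₀)))
  realizes′ zero    (suc x) (suc y) (suc j) (suc k) x≡j y≡k pⱼ<pₖ = *-monoʳ-< 2 (s≤s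
    (ordered j k pⱼ<pₖ x y (ℕ.suc-injective x≡j) (ℕ.suc-injective y≡k)))
  realizes′ (suc i) (suc x) (suc y) j       k       x≡  y≡  pⱼ<pₖ = *-monoʳ-< 2 (s≤s
    (realizes i x y j k (ℕ.suc-injective x≡) (ℕ.suc-injective y≡) pⱼ<pₖ))

-- The recursion starts at the end of the walk: the last pattern realizes itself, and each earlier
-- one puts a single entry in front.
realize : ∀ {r t} (ws : Vec (Perm (suc r)) (suc t)) → Linked (Digraph._⟶_ (PSG (suc r))) ws → Realization ws
realize (w ∷ []) _ = toℕ ∘ lookup (value w) , perm-injective w ∘ toℕ-injective
  , (λ x → toℕ<n (lookup (value w) x))
  , λ { zero x y j k x≡j y≡k wⱼ<wₖ →
        subst₂ (λ x y → lookup (value w) x <ᶠ lookup (value w) y)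
          (toℕ-injective (sym x≡j)) (toℕ-injective (sym y≡k)) wⱼ<wₖ }
realize (w ∷ w′ ∷ ws) (w⟶w′ ∷ linked) = prepend w (w′ ∷ ws) w⟶w′ (realize (w′ ∷ ws) linked)

-- Tight paths inside homogeneous sets

StrictlyMonotone : ∀ {m n} → (Fin m → Fin n) → Set
StrictlyMonotone e = ∀ i j → i <ᶠ j → e i <ᶠ e j

Within : ∀ {l m n} → (Fin m → Fin n) → Vec (Fin n) l → Set
Within e us = ∀ i → ∃ λ x → e x ≡ lookup us i

tabulate-increasing : ∀ {m n} {e : Fin m → Fin n} → StrictlyMonotone e → Increasing (tabulate e)
tabulate-increasing {e = e} mono i j i<j =
  subst₂ _<ᶠ_ (sym (lookup∘tabulate e i)) (sym (lookup∘tabulate e j)) (mono i j i<j)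

-- The realizing numbers serve as ranks within the image of `e`. As `e` is increasing, window `i` of
-- the resulting path has pattern `lookup ws i`, so it is an arrangement that `edge` declares to be
-- an edge.
walk⇒path : ∀ {r t n} {G : RDigraph (suc r) n} {e : Fin (realizationBound r t) → Fin n} → StrictlyMonotone e →
  (ws : Vec (Perm (suc r)) (suc t)) → Linked (Digraph._⟶_ (PSG (suc r))) ws →
  (∀ i us → Increasing us → Within e us → E G (arrange us (lookup ws i))) →
  G Contains tightPath (suc r) (r + suc t)
walk⇒path {r} {t} {n} {G} {e} mono ws linked edge with realize ws linked
... | v , v-inj , v< , realizes = φ , φ-inj , φ-edge
  where
  position : Fin (r + suc t) → Fin (suc t + r)
  position = Fin.cast (+-comm r (suc t))
  value-at : Fin (r + suc t) → Fin (realizationBound r t)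
  value-at x = fromℕ< (v< (position x))
  φ : Fin (r + suc t) → Fin n
  φ = e ∘ value-at
  φ-inj : Injective _≡_ _≡_ φ
  φ-inj {x} {y} eq = toℕ-injective (trans (sym (toℕ-cast (+-comm r (suc t)) x))
    (trans (cong toℕ (v-inj values≡)) (toℕ-cast (+-comm r (suc t)) y)))
    where
    e-inj : Injective _≡_ _≡_ e
    e-inj {i} {j} eᵢ≡eⱼ = unique⇒injective (increasing⇒unique (tabulate e) (tabulate-increasing mono))
      (trans (lookup∘tabulate e i) (trans eᵢ≡eⱼ (sym (lookup∘tabulate e j))))
    values≡ : v (position x) ≡ v (position y)
    values≡ = trans (sym (toℕ-fromℕ< (v< (position x))))
      (trans (cong toℕ (e-inj eq)) (toℕ-fromℕ< (v< (position y))))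
  φ-edge : ∀ {u} → E (tightPath (suc r) (r + suc t)) u → E G (Vec.map φ u)
  φ-edge {u} (i₀ , window) = subst (E G) arranged (edge i us us↑ us-within)
    where
    i<1+t : toℕ i₀ < suc t
    -- A path on `r + suc t` vertices has `suc (r + suc t) ∸ suc r` windows, that is `suc t`.
    i<1+t = subst (toℕ i₀ <_) (m+n∸m≡n r (suc t)) (toℕ<n i₀)
    i : Fin (suc t)
    i = fromℕ< i<1+t
    w : Perm (suc r)
    w = lookup ws i
    w⁻¹ : Fin (suc r) → Fin (suc r)
    w⁻¹ y = proj₁ (perm-surjective w y)
    w∘w⁻¹ : ∀ y → lookup (value w) (w⁻¹ y) ≡ y
    w∘w⁻¹ y = proj₂ (perm-surjective w y)
    -- The vertex of rank `y` in the window stands at place `w⁻¹ y`; sorting by `w⁻¹` and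
    -- rearranging by `w` returns the window.
    sorted : Fin (suc r) → Fin n
    sorted y = φ (lookup u (w⁻¹ y))
    us : Vec (Fin n) (suc r)
    us = tabulate sorted
    position-window : ∀ j → toℕ (position (lookup u j)) ≡ toℕ i + toℕ j
    position-window j = trans (toℕ-cast (+-comm r (suc t)) (lookup u j))
      (trans (window j) (cong (_+ toℕ j) (sym (toℕ-fromℕ< i<1+t))))
    us↑ : Increasing us
    us↑ = tabulate-increasing λ x y x<y → mono _ _
      (subst₂ _<_ (sym (toℕ-fromℕ< (v< _))) (sym (toℕ-fromℕ< (v< _)))
        (realizes i _ _ (w⁻¹ x) (w⁻¹ y) (position-window (w⁻¹ x)) (position-window (w⁻¹ y))
          (subst₂ _<ᶠ_ (sym (w∘w⁻¹ x)) (sym (w∘w⁻¹ y)) x<y)))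
    us-within : Within e us
    us-within y = value-at (lookup u (w⁻¹ y)) , sym (lookup∘tabulate sorted y)
    arranged : arrange us w ≡ Vec.map φ u
    arranged = vec-ext λ j → begin
      lookup (arrange us w) j                       ≡⟨ lookup-arrange us w j ⟩
      lookup us (lookup (value w) j)                ≡⟨ lookup∘tabulate sorted (lookup (value w) j) ⟩
      φ (lookup u (w⁻¹ (lookup (value w) j)))       ≡⟨ cong (φ ∘ lookup u)
                                                          (perm-injective w (w∘w⁻¹ (lookup (value w) j))) ⟩
      φ (lookup u j)                                ≡⟨ lookup-map j φ u ⟨
      lookup (Vec.map φ u) j                        ∎
      where open ≡-Reasoning

initial-increasing : ∀ {l m n} {e : Fin (l + m) → Fin n} → StrictlyMonotone e → Increasing (tabulate (e ∘ (_↑ˡ m)))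
initial-increasing mono = tabulate-increasing λ i j i<j →
  mono _ _ (subst₂ _<_ (sym (toℕ-↑ˡ i _)) (sym (toℕ-↑ˡ j _)) i<j)

allPairs-⊆ : ∀ {A : Set} {R : A → A → Set} {xs ys} → xs ⊆ ys → AllPairs R ys → AllPairs R xs
allPairs-⊆ []             []         = []
allPairs-⊆ (_ ∷ʳ xs⊆ys)   (_ ∷ Rys)  = allPairs-⊆ xs⊆ys Rys
allPairs-⊆ (refl ∷ xs⊆ys) (Ry ∷ Rys) = All-resp-⊆ xs⊆ys Ry ∷ allPairs-⊆ xs⊆ys Rys

allPairs-lookup : ∀ {A : Set} {R : A → A → Set} {xs} → AllPairs R xs →
  ∀ i j → i <ᶠ j → R (List.lookup xs i) (List.lookup xs j)
allPairs-lookup (Rx ∷ _)  zero    (suc j) _         = All.lookup Rx (∈-lookup j)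
allPairs-lookup (_ ∷ Rxs) (suc i) (suc j) (s≤s i<j) = allPairs-lookup Rxs i j i<j

-- If `u` equals the head `y`, the later entries exceed it and lie in the tail. Otherwise `u` lies
-- beyond `y`, so all entries exceed `y`, which can be skipped.
increasing-⊆ : ∀ {n m} (us : Vec (Fin n) m) {ys} → AllPairs _<ᶠ_ ys → Increasing us →
  (∀ i → lookup us i ∈ ys) → toList us ⊆ ys
increasing-⊆ []       _  _ _  = minimum _
increasing-⊆ (u ∷ us) {[]}     _ _ us⊆ with () ← us⊆ zero
increasing-⊆ (u ∷ us) {y ∷ ys} (y< ∷ ys↑) u↑ us⊆ with us⊆ zero
... | here refl = refl ∷ increasing-⊆ us ys↑ (λ i j i<j → u↑ (suc i) (suc j) (s≤s i<j))
  λ i → Any.tail (λ uᵢ≡u → ℕ.<-irrefl (cong toℕ (sym uᵢ≡u)) (u↑ zero (suc i) (s≤s z≤n))) (us⊆ (suc i))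
... | there u∈ys = y ∷ʳ increasing-⊆ (u ∷ us) ys↑ u↑ λ where
  zero    → u∈ys
  (suc i) → Any.tail (λ uᵢ≡y → ℕ.<-asym (All.lookup y< u∈ys)
    (subst (λ z → toℕ u < toℕ z) uᵢ≡y (u↑ zero (suc i) (s≤s z≤n)))) (us⊆ (suc i))

UniformOn : ∀ {r m n} → RDigraph r n → (Fin m → Fin n) → Perm r → Set
UniformOn G e p = (∀ us → Increasing us → Within e us → E G (arrange us p))
                ⊎ (∀ us → Increasing us → Within e us → ¬ E G (arrange us p))

-- For each pattern `p`, an r-set is coloured by whether its arrangement in pattern `p` is an edge.
-- Sublists of `allFin n` are increasing, so they list r-sets in the order that `arrange` expects.
ramsey-digraph : ∀ r m → ∃ λ N → ∀ n → n ≥ N → (G : RDigraph r n) →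
  ∃ λ (e : Fin m → Fin n) → StrictlyMonotone e × ∀ p → UniformOn G e p
ramsey-digraph r m with ramsey-family (allPerms r) r m
... | N , R = N , go
  where
  go : ∀ n → n ≥ N → (G : RDigraph r n) → ∃ λ (e : Fin m → Fin n) → StrictlyMonotone e × ∀ p → UniformOn G e p
  go n n≥N G with R {P = λ p us → E G (arrange us p)} (λ p us → E? G (arrange us p)) (allFin n)
    (subst (N ≤_) (sym (length-tabulate {n = n} id)) n≥N)
  ... | ys , ys⊆ , m≤ , homs = e , mono , λ p → uniform p (All.lookup homs (allPerms-complete p))
    where
    ys↑ : AllPairs _<ᶠ_ ys
    ys↑ = allPairs-⊆ ys⊆ (AllPairs.tabulate⁺-< id)
    e : Fin m → Fin n
    e i = List.lookup ys (inject≤ i m≤)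
    mono : StrictlyMonotone e
    mono i j i<j = allPairs-lookup ys↑ _ _ (subst₂ _<_ (sym (toℕ-inject≤ i m≤)) (sym (toℕ-inject≤ j m≤)) i<j)
    sub : ∀ us → Increasing us → Within e us → toList us ⊆ ys
    sub us us↑ within = increasing-⊆ us ys↑ us↑ λ i → subst (_∈ ys) (proj₂ (within i)) (∈-lookup _)
    uniform : ∀ p → Homogeneous (λ us → E G (arrange us p)) ys ⊎ Homogeneous (∁ (λ us → E G (arrange us p))) ys →
      UniformOn G e p
    uniform p (inj₁ hom) = inj₁ λ us us↑ within → hom us (sub us us↑ within)
    uniform p (inj₂ hom) = inj₂ λ us us↑ within → hom us (sub us us↑ within)

edgePatterns : ∀ {r n k} (G : RDigraph r n) → IsTournament k G → ∀ us → Increasing us →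
  ∃ λ ps → List.Unique ps × length ps ≡ k × ∀ p → p ∈ ps ⇔ E G (arrange us p)
edgePatterns {r} {n} {k} G tour us us↑ =
  ps , ps! , exactly-unique count (tour (range us) (∣range∣ us us!)) , ps⇔
  where
  us! : Unique us
  us! = increasing⇒unique us us↑
  edge? : Decidable (λ p → E G (arrange us p))
  edge? p = E? G (arrange us p)
  ps : List (Perm r)
  ps = filter edge? (allPerms r)
  ps! : List.Unique ps
  ps! = Uniqueₗ.filter⁺ edge? (allPerms-unique r)
  ps⇔ : ∀ p → p ∈ ps ⇔ E G (arrange us p)
  ps⇔ p = mk⇔ (proj₂ ∘ ∈-filter⁻ edge? {xs = allPerms r}) (∈-filter⁺ edge? (allPerms-complete p))
  count : Exactly (length ps) (λ v → IsOrderingOf (range us) v × E G v)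
  count = exactly-orderings us! (range-enumerated us) ps! ps⇔

-- The image of `e` is split: its first `suc r` points are a sample on which every pattern in `ps`
-- is an edge, and the remaining points carry the path. The sample refutes the alternative that such
-- a pattern is never an edge.
uniform⇒path : ∀ {r t n} {G : RDigraph (suc r) n} {e : Fin (suc r + realizationBound r t) → Fin n} →
  StrictlyMonotone e → (∀ p → UniformOn G e p) →
  ∀ {ps} → (∀ {p} → p ∈ ps → E G (arrange (tabulate (e ∘ (_↑ˡ realizationBound r t))) p)) →
  Walk (induced (PSG (suc r)) ps) (suc t) → G Contains tightPath (suc r) (r + suc t)
uniform⇒path {r} {t} {n} {G} {e} mono uniform {ps} ps-edge (ws , linked) =
  walk⇒path {G = G} {e ∘ (suc r ↑ʳ_)} mono′ (Vec.map proj₁ ws) (Linked.map⁺ linked)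
    λ i us us↑ within → subst (λ p → E G (arrange us p)) (sym (lookup-map i proj₁ ws))
      (pattern-edge (lookup ws i) us us↑ within)
  where
  us₀ : Vec (Fin n) (suc r)
  us₀ = tabulate (e ∘ (_↑ˡ realizationBound r t))
  mono′ : StrictlyMonotone (e ∘ (suc r ↑ʳ_))
  mono′ i j i<j = mono _ _ (subst₂ _<_ (sym (toℕ-↑ʳ (suc r) i)) (sym (toℕ-↑ʳ (suc r) j)) (+-monoʳ-< (suc r) i<j))
  pattern-edge : ∀ ((p , _) : ∃ (_∈ ps)) us → Increasing us → Within (e ∘ (suc r ↑ʳ_)) us → E G (arrange us p)
  pattern-edge (p , p∈ps) us us↑ within with uniform p
  ... | inj₁ always = always us us↑ λ i → suc r ↑ʳ proj₁ (within i) , proj₂ (within i)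
  ... | inj₂ never  = contradiction (ps-edge p∈ps)
    (never us₀ (initial-increasing mono) λ i → i ↑ˡ _ , sym (lookup∘tabulate (e ∘ (_↑ˡ realizationBound r t)) i))

-- The threshold

path-forced : ∀ {r t a} → a[ suc t , PSG (suc r) ]≡ a → Eventually λ n →
  ∀ (G : RDigraph (suc r) n) → IsTournament (suc a) G → G Contains tightPath (suc r) (r + suc t)
path-forced {r} {t} {a} (_ , maximal) with ramsey-digraph (suc r) (suc r + realizationBound r t)
... | N , R = N , go
  where
  go : ∀ n → n ≥ N → (G : RDigraph (suc r) n) → IsTournament (suc a) G → G Contains tightPath (suc r) (r + suc t)
  go n n≥N G tour with R n n≥N G
  ... | e , mono , uniform
    with edgePatterns G tour (tabulate (e ∘ (_↑ˡ realizationBound r t))) (initial-increasing mono)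
  ... | ps , ps! , len , ps⇔ = uniform⇒path {G = G} mono uniform (λ {p} → to (ps⇔ p))
    -- Maximality of `a` only refutes the absence of a walk; decidability turns this into a walk.
    (decidable-stable (walk? ps (suc t)) λ walkless → 1+n≰n (maximal (suc a) (ps , ps! , len , walkless)))

-- Any `k` patterns of an extremal set still induce no walk of size `suc t`, so their pattern
-- digraph is a `k`-tournament without the path. There is no condition on `n`.
path-avoidable : ∀ {r t a k n s} → a[ suc t , PSG (suc r) ]≡ a → k ≤ a →
  f[ n , suc r , k ]≡ s → s < r + suc t
path-avoidable {r} {t} {k = k} {n} {s} ((ps , ps! , refl , walkless) , _) k≤a (forced , _) with s ℕ.<? r + suc t
... | yes s< = s<
... | no  s≮ = contradiction
  (walk-⊆ {ps = take k ps} (⊆-lookup (take-⊆ k ps)) (path⇒walk {n = n} enough found)) walkless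
  where
  enough : suc t + r ≤ s
  enough = subst (_≤ s) (+-comm r (suc t)) (≮⇒≥ s≮)
  found : patternDigraph (take k ps) n Contains tightPath (suc r) s
  found = forced (patternDigraph (take k ps) n)
    (subst (λ l → IsTournament l (patternDigraph (take k ps) n)) (length-take-≤ ps k≤a)
      (patternDigraph-tournament (Uniqueₗ.take⁺ k ps!)))

f-eventually-≥ : ∀ {r t a} → a[ suc t , PSG (suc r) ]≡ a → a < suc r ! →
  Eventually λ n → f[ n , suc r , suc a ]≥ (r + suc t)
f-eventually-≥ a-max a<r! = proj₁ (path-forced a-max) , λ n n≥N →
  let s , s-max = f-defined a<r! in s , s-max , proj₂ s-max _ (proj₂ (path-forced a-max) n n≥N)

f-< : ∀ {r t a k n} → a[ suc t , PSG (suc r) ]≡ a → k ≤ a → a < suc r ! → f[ n , suc r , k ]< (r + suc t)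
f-< a-max k≤a a<r! =
  let s , s-max = f-defined (<⇒≤ (≤-<-trans k≤a a<r!)) in s , s-max , path-avoidable a-max k≤a s-max

a<r! : ∀ {r t a} → a[ suc t , PSG (suc r) ]≡ a → a < suc r !
a<r! ((_ , ps! , refl , walkless) , _) = walkless⇒length< ps! walkless

threshold : ∀ {r t a} → a[ suc t , PSG (suc r) ]≡ a → IsThreshold (suc r) (suc t) (suc a)
threshold {r} {t} {a} a-max =
  -- Avoidance holds for every `n`, so the single value `n = N` already refutes `k ≤ a`.
  (a<r! a-max , f-eventually-≥ a-max (a<r! a-max)) , λ k (_ , N , f≥) → minimal k N (f≥ N ≤-refl)
  where
  minimal : ∀ k n → f[ n , suc r , k ]≥ (r + suc t) → suc a ≤ k
  minimal k n (s , s-max , s≥) with suc a ℕ.≤? k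
  ... | yes a<k = a<k
  ... | no  a≮k = contradiction s≥ (<⇒≱ (path-avoidable a-max (≮⇒≥ a≮k) s-max))

theorem2 : ∀ (r t : ℕ) .{{_ : NonZero r}} .{{_ : NonZero t}} →
    ∃ λ a → a[ t , PSG r ]≡ a
    × IsThreshold r t (1 + a)
    × Eventually (λ n → f[ n , r , a ]< (r ∸ 1 + t))
    × Eventually (λ n → f[ n , r , 1 + a ]≥ (r ∸ 1 + t))
theorem2 (suc r) (suc t) = let a , a-max = a-defined r t in
  a , a-max , threshold a-max , (0 , λ n _ → f-< a-max ≤-refl (a<r! a-max)) , f-eventually-≥ a-max (a<r! a-max)
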